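{- For a finite partially ordered set $(N,\leq)$ of tasks and a set of stations $S=\{1,\ldots,m\}$, consider the following three families of linear inequalities in the variables $x=(x_{si})_{s\in S,\,i\in N}$, where $F_i$ is the set of immediate followers of $i$: (NF) $\displaystyle\sum_{s\in S,\ s\leq k}x_{si}\geq\sum_{s\in S,\ s\leq k}x_{sj}$ for all $i\in N$, $j\in F_i$, $k\in S$; (PA) $\displaystyle\sum_{s\in S}s\,x_{si}\leq\sum_{s\in S}s\,x_{sj}$ for all $i\in N$, $j\in F_i$; (BW) $\displaystyle x_{tj}\leq\sum_{s\in S,\ s\leq t}x_{si}$ for all $i\in N$, $j\in F_i$, $t\in S$. Then (NF) strictly dominates (PA), (NF) strictly dominates (BW), and (PA) and (BW) are incomparable.
   Context: For $i\in N$, the set $F_i$ of immediate followers consists of those $j\in N$, $j\neq i$, with $i\leq j$ and no $l\in N\setminus\{i,j\}$ such that $i\leq l\leq j$. The variables $x_{si}$ represent (relaxed) assignments of tasks $i$ to stations $s$. All comparisons are made for the linear relaxation in the presence of the occurrence constraints. For a family $X\in\{\mathrm{NF},\mathrm{PA},\mathrm{BW}\}$, a finite partially ordered set $(N,\leq)$ and an integer $m\geq 1$, let $Q_X(N,\leq,m)$ be the set of all real vectors $x=(x_{si})_{s\in S,\,i\in N}$ with $0\leq x_{si}\leq 1$ for all $s\in S$, $i\in N$, with $\sum_{s\in S}x_{si}=1$ for all $i\in N$, and satisfying all inequalities of the family $X$. Family $X$ dominates family $Y$ if $Q_X(N,\leq,m)\subseteq Q_Y(N,\leq,m)$ for all $(N,\leq)$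 and all $m$. Family $X$ strictly dominates $Y$ if $X$ dominates $Y$ and, in addition, $Q_X(N,\leq,m)\subsetneq Q_Y(N,\leq,m)$ for some $(N,\leq)$ and $m$. Families $X$ and $Y$ are incomparable if neither dominates the other. -}

module Defs where

open import Algebra.Bundles.Raw using (RawMonoid)
import Algebra.Definitions.RawMonoid as RawMonoidDefinitions
open import Data.Bool using (if_then_else_)
open import Data.Fin as Fin using (Fin; toℕ)
open import Data.Nat as ℕ using (ℕ; suc; NonZero)
import Data.Nat.Properties as ℕ
open import Data.Product using (Σ-syntax; ∃-syntax; _×_; _,_)
open import Data.Rational using (ℚ; 0ℚ; 1ℚ; ½; _+_; _*_; _-_; ∣_∣; _≤_; _<_)
import Data.Rational.Properties as ℚ
open import Data.Rational.Solver using (module +-*-Solver)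
open import Function using (_↔_)
open import Level using (0ℓ)
open import Relation.Binary using (Rel; IsPartialOrder)
open import Relation.Binary.PropositionalEquality
  using (_≡_; _≢_; refl; sym; trans; cong; subst)
open import Relation.Nullary using (¬_; does)
open import Relation.Unary using (Pred; _⊆_; _⊂_)

-- Real numbers as Cauchy sequences of rationals.  No quotient is taken: _≃_ is
-- equality of reals.  The sets Q below are closed under pointwise _≃_, so
-- inclusions between them are inclusions between sets of real vectors.

record ℝ : Set where
  constructor mkℝ
  field
    seq    : ℕ → ℚ
    cauchy : ∀ ε → 0ℚ < ε →
             ∃[ n₀ ] ∀ m n → n₀ ℕ.≤ m → n₀ ℕ.≤ n → ∣ seq m - seq n ∣ < ε

open ℝ public

infix 4 _≃_ _≤ℝ_

_≃_ : Rel ℝ 0ℓ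
x ≃ y = ∀ ε → 0ℚ < ε → ∃[ n₀ ] ∀ n → n₀ ℕ.≤ n → ∣ seq x n - seq y n ∣ < ε

-- The slack ε is essential: termwise eventual _≤_ would not respect _≃_.
_≤ℝ_ : Rel ℝ 0ℓ
x ≤ℝ y = ∀ ε → 0ℚ < ε → ∃[ n₀ ] ∀ n → n₀ ℕ.≤ n → seq x n ≤ seq y n + ε

fromℚ : ℚ → ℝ
fromℚ q = mkℝ (λ _ → q)
  λ ε 0<ε → 0 , λ _ _ _ _ → subst (λ r → ∣ r ∣ < ε) (sym (ℚ.+-inverseʳ q)) 0<ε

0ℝ 1ℝ : ℝ
0ℝ = fromℚ 0ℚ
1ℝ = fromℚ 1ℚ

infixl 6 _+ℝ_

_+ℝ_ : ℝ → ℝ → ℝ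
x +ℝ y = mkℝ (λ n → seq x n + seq y n) +-cauchy
  where
  rearrange : ∀ a b c d → (a + b) - (c + d) ≡ (a - c) + (b - d)
  rearrange = solve 4
    (λ a b c d → (a :+ b) :- (c :+ d) := (a :- c) :+ (b :- d)) refl
    where open +-*-Solver

  ½+½ : ∀ ε → ½ * ε + ½ * ε ≡ ε
  ½+½ ε = trans (sym (ℚ.*-distribʳ-+ ε ½ ½)) (ℚ.*-identityˡ ε)

  +-cauchy : ∀ ε → 0ℚ < ε → ∃[ n₀ ] ∀ m n → n₀ ℕ.≤ m → n₀ ℕ.≤ n →
             ∣ (seq x m + seq y m) - (seq x n + seq y n) ∣ < ε
  +-cauchy ε 0<ε
    with cauchy x (½ * ε) (subst (_< ½ * ε) (ℚ.*-zeroʳ ½) (ℚ.*-monoʳ-<-pos ½ 0<ε))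
       | cauchy y (½ * ε) (subst (_< ½ * ε) (ℚ.*-zeroʳ ½) (ℚ.*-monoʳ-<-pos ½ 0<ε))
  ... | a , p | b , q = a ℕ.⊔ b , λ m n am an → begin-strict
    ∣ (seq x m + seq y m) - (seq x n + seq y n) ∣
      ≡⟨ cong ∣_∣ (rearrange (seq x m) (seq y m) (seq x n) (seq y n)) ⟩
    ∣ (seq x m - seq x n) + (seq y m - seq y n) ∣
      ≤⟨ ℚ.∣p+q∣≤∣p∣+∣q∣ (seq x m - seq x n) (seq y m - seq y n) ⟩
    ∣ seq x m - seq x n ∣ + ∣ seq y m - seq y n ∣
      <⟨ ℚ.+-mono-< (p m n (ℕ.m⊔n≤o⇒m≤o a b am) (ℕ.m⊔n≤o⇒m≤o a b an))
                    (q m n (ℕ.m⊔n≤o⇒n≤o a b am) (ℕ.m⊔n≤o⇒n≤o a b an)) ⟩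
    ½ * ε + ½ * ε
      ≡⟨ ½+½ ε ⟩
    ε ∎
    where open ℚ.≤-Reasoning

+ℝ-rawMonoid : RawMonoid 0ℓ 0ℓ
+ℝ-rawMonoid = record { Carrier = ℝ ; _≈_ = _≃_ ; _∙_ = _+ℝ_ ; ε = 0ℝ }

open RawMonoidDefinitions +ℝ-rawMonoid public
  using (sum) renaming (_×_ to infixr 8 _·_)

record FinitePoset : Set₁ where
  infix 4 _≼_
  field
    N              : Set
    finite         : ∃[ n ] (N ↔ Fin n)
    _≼_            : Rel N 0ℓ
    isPartialOrder : IsPartialOrder _≡_ _≼_

  F : N → Pred N 0ℓ
  F i j = j ≢ i × i ≼ j × ¬ (∃[ l ] (l ≢ i × l ≢ j × i ≼ l × l ≼ j))

-- Station s ∈ {1,…,m} is the element of Fin m whose toℕ is s - 1.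
label : ∀ {m} → Fin m → ℕ
label s = suc (toℕ s)

sumUpTo : ∀ {m} → Fin m → (Fin m → ℝ) → ℝ
sumUpTo k f = sum (λ s → if does (s Fin.≤? k) then f s else 0ℝ)

data Family : Set where
  NF PA BW : Family

module _ (P : FinitePoset) (m : ℕ) where
  open FinitePoset P

  Satisfies : Family → Pred (Fin m → N → ℝ) 0ℓ
  Satisfies NF x = ∀ i j → F i j → ∀ k →
    sumUpTo k (λ s → x s j) ≤ℝ sumUpTo k (λ s → x s i)
  Satisfies PA x = ∀ i j → F i j →
    sum (λ s → label s · x s i) ≤ℝ sum (λ s → label s · x s j)
  Satisfies BW x = ∀ i j → F i j → ∀ t →
    x t j ≤ℝ sumUpTo t (λ s → x s i)

  Q : Family → Pred (Fin m → N → ℝ) 0ℓ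
  Q X x = (∀ s i → 0ℝ ≤ℝ x s i × x s i ≤ℝ 1ℝ)
        × (∀ i → sum (λ s → x s i) ≃ 1ℝ)
        × Satisfies X x

Dominates : Family → Family → Set₁
Dominates X Y = ∀ P m → .{{NonZero m}} → Q P m X ⊆ Q P m Y

StrictlyDominates : Family → Family → Set₁
StrictlyDominates X Y =
  Dominates X Y × Σ[ P ∈ FinitePoset ] ∃[ m ] (NonZero m × Q P m X ⊂ Q P m Y)

Incomparable : Family → Family → Set₁
Incomparable X Y = ¬ Dominates X Y × ¬ Dominates Y X

{-# OPTIONS --safe #-}

-- Write P_k(f) for the partial sum f_1 + … + f_k.  Then
-- Σ_k P_k(f) + Σ_s s f_s = (m + 1) Σ_s f_s, and this is m + 1 for each task, so
-- the (NF) inequalities, summed over k, give (PA).  Since x_tj is a summand of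
-- P_t(x_j), (NF) also gives (BW).  On the two-element chain with three stations,
-- two half-integral points separate (PA) from (BW) in both directions; as (NF)
-- dominates both, the same points show that it does so strictly.
module Submission where

open import Defs
open import Algebra.Bundles using (CommutativeMonoid)
open import Algebra.Structures using (IsCommutativeMonoid)
open import Data.Bool using (true; false; if_then_else_)
open import Data.Fin as Fin using (Fin; zero; suc)
open import Data.Fin.Patterns using (0F; 1F; 2F)
import Data.Fin.Properties as Fin
open import Data.Nat as ℕ using (ℕ; zero; suc; z≤n)
import Data.Nat.Properties as ℕ
open import Data.Product using (_×_; _,_; proj₁; proj₂)
open import Data.Rational
  using (ℚ; 0ℚ; 1ℚ; ½; _+_; _*_; _-_; -_; ∣_∣; _≤_; _<_; _≤?_; _<?_)
import Data.Rational.Properties as ℚ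
open import Data.Rational.Solver using (module +-*-Solver)
open import Data.Sum using (inj₁; inj₂)
open import Function using (_∘_)
open import Function.Construct.Identity using (↔-id)
open import Level using (0ℓ)
open import Relation.Binary
  using (Reflexive; Symmetric; Transitive; IsEquivalence; IsPreorder; Preorder)
open import Relation.Binary.PropositionalEquality
  using (_≡_; refl; sym; trans; cong; subst; subst₂)
open import Relation.Nullary using (¬_; Dec; does; contradiction; _×-dec_)
open import Relation.Nullary.Decidable using (dec-true; from-yes; from-no)
open +-*-Solver using (solve; _:+_; _:-_; :-_; _:=_)

-- Rational estimates for the ε-arguments

p≤∣p∣ : ∀ p → p ≤ ∣ p ∣
p≤∣p∣ p with ℚ.∣p∣≡p∨∣p∣≡-p p
... | inj₁ ∣p∣≡p  = ℚ.≤-reflexive (sym ∣p∣≡p)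
... | inj₂ ∣p∣≡-p = ℚ.≤-trans p≤0 0≤∣p∣
  where
  0≤∣p∣ : 0ℚ ≤ ∣ p ∣
  0≤∣p∣ = ℚ.nonNegative⁻¹ ∣ p ∣ {{ℚ.∣-∣-nonNeg p}}

  p≤0 : p ≤ 0ℚ
  p≤0 = subst (_≤ 0ℚ)
    (trans (cong -_ ∣p∣≡-p) (solve 1 (λ a → :- (:- a) := a) refl p))
    (ℚ.neg-antimono-≤ 0≤∣p∣)

∣p∣≤q : ∀ {p q} → p ≤ q → - p ≤ q → ∣ p ∣ ≤ q
∣p∣≤q {p} p≤q -p≤q with ℚ.∣p∣≡p∨∣p∣≡-p p
... | inj₁ eq = subst (_≤ _) (sym eq) p≤q
... | inj₂ eq = subst (_≤ _) (sym eq) -p≤q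

p-q≤r⇒p≤q+r : ∀ {p q r} → p - q ≤ r → p ≤ q + r
p-q≤r⇒p≤q+r {p} {q} p-q≤r = subst (_≤ q + _)
  (solve 2 (λ p q → q :+ (p :- q) := p) refl p q) (ℚ.+-monoʳ-≤ q p-q≤r)

p≤q+r⇒p-q≤r : ∀ {p q r} → p ≤ q + r → p - q ≤ r
p≤q+r⇒p-q≤r {p} {q} {r} p≤q+r = subst (p - q ≤_)
  (solve 2 (λ q r → (q :+ r) :- q := r) refl q r) (ℚ.+-monoˡ-≤ (- q) p≤q+r)

½ε+½ε≡ε : ∀ ε → ½ * ε + ½ * ε ≡ ε
½ε+½ε≡ε ε = trans (sym (ℚ.*-distribʳ-+ ε ½ ½)) (ℚ.*-identityˡ ε)

0<½ε : ∀ {ε} → 0ℚ < ε → 0ℚ < ½ * ε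
0<½ε {ε} 0<ε = subst (_< ½ * ε) (ℚ.*-zeroʳ ½) (ℚ.*-monoʳ-<-pos ½ 0<ε)

½ε<ε : ∀ {ε} → 0ℚ < ε → ½ * ε < ε
½ε<ε {ε} 0<ε = subst₂ _<_ (ℚ.+-identityʳ (½ * ε)) (½ε+½ε≡ε ε)
  (ℚ.+-monoʳ-< (½ * ε) (0<½ε 0<ε))

-- The reals as a preordered commutative monoid

-- _≃_ and _≤ℝ_ unfold to function types that mention only the sequences, so Agda
-- cannot recover the two reals and they are passed explicitly throughout.
pointwise-≤ : ∀ {x y} → (∀ n → seq x n ≤ seq y n) → x ≤ℝ y
pointwise-≤ {x} {y} x≤y ε 0<ε = 0 , λ n _ → subst (_≤ seq y n + ε)
  (ℚ.+-identityʳ (seq x n)) (ℚ.+-mono-≤ (x≤y n) (ℚ.<⇒≤ 0<ε))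

≤ℝ-refl : Reflexive _≤ℝ_
≤ℝ-refl {x} = pointwise-≤ {x} {x} λ _ → ℚ.≤-refl

≤ℝ-trans : Transitive _≤ℝ_
≤ℝ-trans {x} {y} {z} x≤y y≤z ε 0<ε
  with x≤y (½ * ε) (0<½ε 0<ε) | y≤z (½ * ε) (0<½ε 0<ε)
... | a , p | b , q = a ℕ.⊔ b , λ n ab≤n → begin
  seq x n                    ≤⟨ p n (ℕ.m⊔n≤o⇒m≤o a b ab≤n) ⟩
  seq y n + ½ * ε            ≤⟨ ℚ.+-monoˡ-≤ (½ * ε) (q n (ℕ.m⊔n≤o⇒n≤o a b ab≤n)) ⟩
  (seq z n + ½ * ε) + ½ * ε  ≡⟨ ℚ.+-assoc (seq z n) (½ * ε) (½ * ε) ⟩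
  seq z n + (½ * ε + ½ * ε)  ≡⟨ cong (seq z n +_) (½ε+½ε≡ε ε) ⟩
  seq z n + ε                ∎
  where open ℚ.≤-Reasoning

+ℝ-mono-≤ : ∀ {x y u v} → x ≤ℝ y → u ≤ℝ v → x +ℝ u ≤ℝ y +ℝ v
+ℝ-mono-≤ {x} {y} {u} {v} x≤y u≤v ε 0<ε
  with x≤y (½ * ε) (0<½ε 0<ε) | u≤v (½ * ε) (0<½ε 0<ε)
... | a , p | b , q = a ℕ.⊔ b , λ n ab≤n → begin
  seq x n + seq u n
    ≤⟨ ℚ.+-mono-≤ (p n (ℕ.m⊔n≤o⇒m≤o a b ab≤n)) (q n (ℕ.m⊔n≤o⇒n≤o a b ab≤n)) ⟩
  (seq y n + ½ * ε) + (seq v n + ½ * ε)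
    ≡⟨ solve 3 (λ y v h → (y :+ h) :+ (v :+ h) := (y :+ v) :+ (h :+ h)) refl
         (seq y n) (seq v n) (½ * ε) ⟩
  (seq y n + seq v n) + (½ * ε + ½ * ε)
    ≡⟨ cong (seq y n + seq v n +_) (½ε+½ε≡ε ε) ⟩
  (seq y n + seq v n) + ε ∎
  where open ℚ.≤-Reasoning

+ℝ-cancelˡ-≤ : ∀ z {x y} → z +ℝ x ≤ℝ z +ℝ y → x ≤ℝ y
+ℝ-cancelˡ-≤ z {x} {y} zx≤zy ε 0<ε with zx≤zy ε 0<ε
... | a , p = a , λ n a≤n → subst₂ _≤_
  (solve 2 (λ z x → :- z :+ (z :+ x) := x) refl (seq z n) (seq x n))
  (solve 3 (λ z y ε → :- z :+ ((z :+ y) :+ ε) := y :+ ε) refl (seq z n) (seq y n) ε)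
  (ℚ.+-monoʳ-≤ (- seq z n) (p n a≤n))

-- With slack ½ε in both directions the distance is at most ½ε, which lies strictly below ε as `_≃_`
-- demands.
≤ℝ-antisym : ∀ {x y} → x ≤ℝ y → y ≤ℝ x → x ≃ y
≤ℝ-antisym {x} {y} x≤y y≤x ε 0<ε
  with x≤y (½ * ε) (0<½ε 0<ε) | y≤x (½ * ε) (0<½ε 0<ε)
... | a , p | b , q = a ℕ.⊔ b , λ n ab≤n → ℚ.≤-<-trans
  (∣p∣≤q
    (p≤q+r⇒p-q≤r (p n (ℕ.m⊔n≤o⇒m≤o a b ab≤n)))
    (subst (_≤ ½ * ε)
      (solve 2 (λ x y → y :- x := :- (x :- y)) refl (seq x n) (seq y n))
      (p≤q+r⇒p-q≤r (q n (ℕ.m⊔n≤o⇒n≤o a b ab≤n)))))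
  (½ε<ε 0<ε)

≃⇒≤ℝ : ∀ {x y} → x ≃ y → x ≤ℝ y
≃⇒≤ℝ x≃y ε 0<ε with x≃y ε 0<ε
... | a , p = a , λ n a≤n →
  p-q≤r⇒p≤q+r (ℚ.≤-trans (p≤∣p∣ _) (ℚ.<⇒≤ (p n a≤n)))

≃-sym : Symmetric _≃_
≃-sym {x} {y} x≃y ε 0<ε with x≃y ε 0<ε
... | a , p = a , λ n a≤n → subst (_< ε)
  (trans (sym (ℚ.∣-p∣≡∣p∣ (seq x n - seq y n)))
    (cong ∣_∣ (solve 2 (λ x y → :- (x :- y) := y :- x) refl (seq x n) (seq y n))))
  (p n a≤n)

-- Because addition is termwise, the monoid laws below are equations between sequences and enter
-- `_≃_` through this lemma.
pointwise-≡ : ∀ {x y} → (∀ n → seq x n ≡ seq y n) → x ≃ y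
pointwise-≡ {x} {y} x≡y = ≤ℝ-antisym {x} {y}
  (pointwise-≤ {x} {y} (ℚ.≤-reflexive ∘ x≡y))
  (pointwise-≤ {y} {x} (ℚ.≤-reflexive ∘ sym ∘ x≡y))

-- Antisymmetry of `_≤ℝ_` reduces this to `≤ℝ-trans`, so ε is not split again; `+ℝ-cong` follows the
-- same pattern.
≃-trans : Transitive _≃_
≃-trans {x} {y} {z} x≃y y≃z = ≤ℝ-antisym {x} {z}
  (≤ℝ-trans {x} {y} {z} (≃⇒≤ℝ {x} {y} x≃y) (≃⇒≤ℝ {y} {z} y≃z))
  (≤ℝ-trans {z} {y} {x} (≃⇒≤ℝ {z} {y} (≃-sym {y} {z} y≃z)) (≃⇒≤ℝ {y} {x} (≃-sym {x} {y} x≃y)))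

≃-isEquivalence : IsEquivalence _≃_
≃-isEquivalence = record
  { refl  = λ {x} → pointwise-≡ {x} {x} λ _ → refl
  ; sym   = λ {x} {y} → ≃-sym {x} {y}
  ; trans = λ {x} {y} {z} → ≃-trans {x} {y} {z}
  }

≤ℝ-isPreorder : IsPreorder _≃_ _≤ℝ_
≤ℝ-isPreorder = record
  { isEquivalence = ≃-isEquivalence
  ; reflexive     = λ {x} {y} → ≃⇒≤ℝ {x} {y}
  ; trans         = λ {x} {y} {z} → ≤ℝ-trans {x} {y} {z}
  }

≤ℝ-preorder : Preorder 0ℓ 0ℓ 0ℓ
≤ℝ-preorder = record { isPreorder = ≤ℝ-isPreorder }

+ℝ-cong : ∀ {x y u v} → x ≃ y → u ≃ v → x +ℝ u ≃ y +ℝ v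
+ℝ-cong {x} {y} {u} {v} x≃y u≃v = ≤ℝ-antisym {x +ℝ u} {y +ℝ v}
  (+ℝ-mono-≤ {x} {y} {u} {v} (≃⇒≤ℝ {x} {y} x≃y) (≃⇒≤ℝ {u} {v} u≃v))
  (+ℝ-mono-≤ {y} {x} {v} {u}
    (≃⇒≤ℝ {y} {x} (≃-sym {x} {y} x≃y)) (≃⇒≤ℝ {v} {u} (≃-sym {u} {v} u≃v)))

+ℝ-isCommutativeMonoid : IsCommutativeMonoid _≃_ _+ℝ_ 0ℝ
+ℝ-isCommutativeMonoid = record
  { isMonoid = record
    { isSemigroup = record
      { isMagma = record
        { isEquivalence = ≃-isEquivalence
        ; ∙-cong        = λ {x} {y} {u} {v} → +ℝ-cong {x} {y} {u} {v}
        }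
      ; assoc = λ x y z → pointwise-≡ {(x +ℝ y) +ℝ z} {x +ℝ (y +ℝ z)}
                  λ n → ℚ.+-assoc (seq x n) (seq y n) (seq z n)
      }
    ; identity = (λ x → pointwise-≡ {0ℝ +ℝ x} {x} λ n → ℚ.+-identityˡ (seq x n))
               , (λ x → pointwise-≡ {x +ℝ 0ℝ} {x} λ n → ℚ.+-identityʳ (seq x n))
    }
  ; comm = λ x y → pointwise-≡ {x +ℝ y} {y +ℝ x} λ n → ℚ.+-comm (seq x n) (seq y n)
  }

-- `sum` and `_·_` come from the raw monoid underlying this bundle, so the library lemmas on finite
-- sums and multiples apply to them directly.
+ℝ-commutativeMonoid : CommutativeMonoid 0ℓ 0ℓ
+ℝ-commutativeMonoid = record { isCommutativeMonoid = +ℝ-isCommutativeMonoid }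

open CommutativeMonoid +ℝ-commutativeMonoid using (setoid)
  renaming (∙-congˡ to +ℝ-congˡ; ∙-congʳ to +ℝ-congʳ; comm to +ℝ-comm;
            identityˡ to +ℝ-identityˡ; identityʳ to +ℝ-identityʳ;
            refl to ≃-refl; commutativeSemigroup to +ℝ-commutativeSemigroup)
open import Algebra.Properties.CommutativeSemigroup +ℝ-commutativeSemigroup
  using (x∙yz≈y∙xz)
open import Algebra.Properties.CommutativeMonoid.Sum +ℝ-commutativeMonoid
  using (sum-cong-≋; sum-replicate; ∑-distrib-+; ∑-comm)
open import Algebra.Properties.CommutativeMonoid.Mult +ℝ-commutativeMonoid
  using (×-congʳ)

-- Finite sums

sum-mono-≤ : ∀ {m} (f g : Fin m → ℝ) → (∀ s → f s ≤ℝ g s) → sum f ≤ℝ sum g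
sum-mono-≤ {zero}  f g f≤g = ≤ℝ-refl {0ℝ}
sum-mono-≤ {suc m} f g f≤g =
  +ℝ-mono-≤ {f zero} {g zero} {sum (f ∘ suc)} {sum (g ∘ suc)}
    (f≤g zero) (sum-mono-≤ (f ∘ suc) (g ∘ suc) (f≤g ∘ suc))

sum-nonNegative : ∀ {m} (f : Fin m → ℝ) → (∀ s → 0ℝ ≤ℝ f s) → 0ℝ ≤ℝ sum f
sum-nonNegative {zero}  f 0≤f = ≤ℝ-refl {0ℝ}
sum-nonNegative {suc m} f 0≤f = +ℝ-mono-≤ {0ℝ} {f zero} {0ℝ} {sum (f ∘ suc)}
  (0≤f zero) (sum-nonNegative (f ∘ suc) (0≤f ∘ suc))

term≤sum : ∀ {m} (f : Fin m → ℝ) → (∀ s → 0ℝ ≤ℝ f s) → ∀ t → f t ≤ℝ sum f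
term≤sum f 0≤f zero = begin
  f zero                     ≈⟨ +ℝ-identityʳ (f zero) ⟨
  f zero +ℝ 0ℝ               ≲⟨ +ℝ-mono-≤ {f zero} {f zero} {0ℝ} {sum (f ∘ suc)}
                                  (≤ℝ-refl {f zero}) (sum-nonNegative (f ∘ suc) (0≤f ∘ suc)) ⟩
  f zero +ℝ sum (f ∘ suc)    ∎
  where open import Relation.Binary.Reasoning.Preorder ≤ℝ-preorder
term≤sum f 0≤f (suc t) = begin
  f (suc t)                  ≈⟨ +ℝ-identityˡ (f (suc t)) ⟨
  0ℝ +ℝ f (suc t)            ≲⟨ +ℝ-mono-≤ {0ℝ} {f zero} {f (suc t)} {sum (f ∘ suc)}
                                  (0≤f zero) (term≤sum (f ∘ suc) (0≤f ∘ suc) t) ⟩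
  f zero +ℝ sum (f ∘ suc)    ∎
  where open import Relation.Binary.Reasoning.Preorder ≤ℝ-preorder

-- A multiple is a sum of n equal terms, so this is an exchange of two finite sums.
sum-· : ∀ {m} n (f : Fin m → ℝ) → sum (λ s → n · f s) ≃ n · sum f
sum-· {m} n f = begin
  sum (λ s → n · f s)                     ≈⟨ sum-cong-≋ (λ s → sum-replicate n {f s}) ⟨
  sum (λ s → sum {n} (λ _ → f s))         ≈⟨ ∑-comm {m} {n} (λ s _ → f s) ⟩
  sum {n} (λ _ → sum f)                   ≈⟨ sum-replicate n {sum f} ⟩
  n · sum f                               ∎
  where open import Relation.Binary.Reasoning.Setoid setoid

-- There are m + 1 − s thresholds k ≥ s.
sum-thresholds : ∀ {m} (s : Fin m) x →
  sum {m} (λ k → if does (s Fin.≤? k) then x else 0ℝ) +ℝ label s · x ≃ suc m · x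
sum-thresholds {suc m} zero x = begin
  -- Every threshold admits the first station, so all `suc m` terms are `x`; its label 1 adds one
  -- more.
  sum {suc m} (λ _ → x) +ℝ 1 · x
    ≈⟨ +ℝ-cong {sum {suc m} (λ _ → x)} {suc m · x} {1 · x} {x}
         (sum-replicate (suc m) {x}) (+ℝ-identityʳ x) ⟩
  suc m · x +ℝ x
    ≈⟨ +ℝ-comm (suc m · x) x ⟩
  suc (suc m) · x ∎
  where open import Relation.Binary.Reasoning.Setoid setoid
sum-thresholds {suc m} (suc s) x = begin
  -- The lowest threshold excludes `suc s` and contributes `0ℝ`; the remaining ones are those of `s`
  -- shifted by one. The extra `x` from the larger label makes up for it.
  (0ℝ +ℝ sum h′) +ℝ (x +ℝ label s · x)
    ≈⟨ +ℝ-congʳ {x +ℝ label s · x} {0ℝ +ℝ sum h′} {sum h}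
         (≃-trans {0ℝ +ℝ sum h′} {sum h′} {sum h}
           (+ℝ-identityˡ (sum h′)) (sum-cong-≋ h′≃h)) ⟩
  sum h +ℝ (x +ℝ label s · x)
    ≈⟨ x∙yz≈y∙xz (sum h) x (label s · x) ⟩
  x +ℝ (sum h +ℝ label s · x)
    ≈⟨ +ℝ-congˡ {x} {sum h +ℝ label s · x} {suc m · x} (sum-thresholds s x) ⟩
  suc (suc m) · x ∎
  where
  open import Relation.Binary.Reasoning.Setoid setoid
  h h′ : Fin m → ℝ
  h  k = if does (s Fin.≤? k) then x else 0ℝ
  h′ k = if does (suc s Fin.≤? suc k) then x else 0ℝ

  -- The two tests reduce to the same Boolean only once `s` is split.
  suc-≤?-suc : ∀ {m} (s k : Fin m) → does (suc s Fin.≤? suc k) ≡ does (s Fin.≤? k)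
  suc-≤?-suc zero    k = refl
  suc-≤?-suc (suc s) k = refl

  h′≃h : ∀ k → h′ k ≃ h k
  h′≃h k rewrite suc-≤?-suc s k = ≃-refl {h k}

-- Exchanging the summations collects at each station the thresholds counted by `sum-thresholds`;
-- with its label added, every station has the same weight m + 1.
sum-partialSums : ∀ {m} (f : Fin m → ℝ) →
  sum (λ k → sumUpTo k f) +ℝ sum (λ s → label s · f s) ≃ suc m · sum f
sum-partialSums {m} f = begin
  sum (λ k → sum (λ s → [ s ≤ k ] s)) +ℝ sum (λ s → label s · f s)
    ≈⟨ +ℝ-congʳ {sum (λ s → label s · f s)}
         {sum (λ k → sum (λ s → [ s ≤ k ] s))} {sum (λ s → sum (λ k → [ s ≤ k ] s))}
         (∑-comm (λ k s → [ s ≤ k ] s)) ⟩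
  sum (λ s → sum (λ k → [ s ≤ k ] s)) +ℝ sum (λ s → label s · f s)
    ≈⟨ ∑-distrib-+ (λ s → sum (λ k → [ s ≤ k ] s)) (λ s → label s · f s) ⟨
  sum (λ s → sum (λ k → [ s ≤ k ] s) +ℝ label s · f s)
    ≈⟨ sum-cong-≋ (λ s → sum-thresholds s (f s)) ⟩
  sum (λ s → suc m · f s)
    ≈⟨ sum-· (suc m) f ⟩
  suc m · sum f ∎
  where
  open import Relation.Binary.Reasoning.Setoid setoid
  [_≤_]_ : Fin m → Fin m → Fin m → ℝ
  [ s ≤ k ] t = if does (s Fin.≤? k) then f t else 0ℝ

-- This is comparison of means under first-order stochastic dominance. By `sum-partialSums`, summed
-- partial sums and mean have the same total for `f` and `g`, so a larger first part forces a
-- smaller mean.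
partialSums-≤⇒mean-≥ : ∀ {m} (f g : Fin m → ℝ) → sum f ≃ sum g →
  (∀ k → sumUpTo k g ≤ℝ sumUpTo k f) →
  sum (λ s → label s · f s) ≤ℝ sum (λ s → label s · g s)
partialSums-≤⇒mean-≥ {m} f g Σf≃Σg g≤f =
  +ℝ-cancelˡ-≤ (Σpartial f) {mean f} {mean g} (begin
    Σpartial f +ℝ mean f  ≈⟨ sum-partialSums f ⟩
    suc m · sum f         ≈⟨ ×-congʳ (suc m) {sum f} {sum g} Σf≃Σg ⟩
    suc m · sum g         ≈⟨ sum-partialSums g ⟨
    Σpartial g +ℝ mean g  ≲⟨ +ℝ-mono-≤ {Σpartial g} {Σpartial f} {mean g} {mean g}
                               (sum-mono-≤ (λ k → sumUpTo k g) (λ k → sumUpTo k f) g≤f)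
                               (≤ℝ-refl {mean g}) ⟩
    Σpartial f +ℝ mean g  ∎)
  where
  open import Relation.Binary.Reasoning.Preorder ≤ℝ-preorder
  Σpartial mean : (Fin m → ℝ) → ℝ
  Σpartial f = sum (λ k → sumUpTo k f)
  mean f = sum (λ s → label s · f s)

-- Apply `term≤sum` to `f` cut off after `t`; the cut keeps the term at `t` itself.
term≤sumUpTo : ∀ {m} (f : Fin m → ℝ) → (∀ s → 0ℝ ≤ℝ f s) → ∀ t → f t ≤ℝ sumUpTo t f
term≤sumUpTo {m} f 0≤f t = subst (_≤ℝ sum h) ht≡ft (term≤sum h 0≤h t)
  where
  h : Fin m → ℝ
  h s = if does (s Fin.≤? t) then f s else 0ℝ

  0≤h : ∀ s → 0ℝ ≤ℝ h s
  0≤h s with does (s Fin.≤? t)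
  ... | true  = 0≤f s
  ... | false = ≤ℝ-refl {0ℝ}

  ht≡ft : h t ≡ f t
  ht≡ft = cong (if_then f t else 0ℝ) (dec-true (t Fin.≤? t) ℕ.≤-refl)

-- The two dominations by (NF)

NF-dominates-PA : Dominates NF PA
NF-dominates-PA P m {x} (bounds , Σx≃1 , nf) = bounds , Σx≃1 , λ i j i⋖j →
  partialSums-≤⇒mean-≥ (λ s → x s i) (λ s → x s j)
    -- The occurrence constraints give both tasks the same total.
    (≃-trans {sum (λ s → x s i)} {1ℝ} {sum (λ s → x s j)}
      (Σx≃1 i) (≃-sym {sum (λ s → x s j)} {1ℝ} (Σx≃1 j)))
    (nf i j i⋖j)

NF-dominates-BW : Dominates NF BW
NF-dominates-BW P m {x} (bounds , Σx≃1 , nf) = bounds , Σx≃1 , λ i j i⋖j t →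
  ≤ℝ-trans {x t j} {sumUpTo t (λ s → x s j)} {sumUpTo t (λ s → x s i)}
    (term≤sumUpTo (λ s → x s j) (λ s → proj₁ (bounds s j)) t)
    (nf i j i⋖j t)

-- Separating points on the two-element chain

chain₂ : FinitePoset
chain₂ = record
  { N              = Fin 2
  ; finite         = 2 , ↔-id (Fin 2)
  ; _≼_            = Fin._≤_
  ; isPartialOrder = Fin.≤-isPartialOrder
  }

open FinitePoset chain₂ using (F)

0⋖1 : F 0F 1F
0⋖1 = (λ ()) , z≤n , λ
  { (0F , l≢0 , _)       → l≢0 refl
  ; (1F , _ , l≢1 , _)   → l≢1 refl
  }

-- Membership of a point in `Q` thus needs a check at one pair of tasks only.
F⇒0⋖1 : ∀ i j → F i j → i ≡ 0F × j ≡ 1F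
F⇒0⋖1 0F 0F (j≢i , _)    = contradiction refl j≢i
F⇒0⋖1 0F 1F _            = refl , refl
F⇒0⋖1 1F 0F (_ , () , _)
F⇒0⋖1 1F 1F (j≢i , _)    = contradiction refl j≢i

-- In `late-follower` both means are 2, but the follower has ½ on the first station, where its
-- predecessor has nothing. In `early-follower` no entry of the follower exceeds the ½ that its
-- predecessor has on the first station, yet the means are 2 and 3/2.
late-follower early-follower : Fin 3 → Fin 2 → ℚ

late-follower 0F 0F = 0ℚ
late-follower 0F 1F = ½
late-follower 1F 0F = 1ℚ
late-follower 1F 1F = 0ℚ
late-follower 2F 0F = 0ℚ
late-follower 2F 1F = ½

early-follower 0F 0F = ½
early-follower 0F 1F = ½
early-follower 1F 0F = 0ℚ
early-follower 1F 1F = ½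
early-follower 2F 0F = ½
early-follower 2F 1F = 0ℚ

rational : (Fin 3 → Fin 2 → ℚ) → Fin 3 → Fin 2 → ℝ
rational a s i = fromℚ (a s i)

-- Sums of constant sequences are constant, so the entry at 0 settles the occurrence constraint.
rational∈Q : ∀ X a → (∀ s i → 0ℚ ≤ a s i × a s i ≤ 1ℚ) →
  (∀ i → seq (sum (λ s → rational a s i)) 0 ≡ 1ℚ) →
  Satisfies chain₂ 3 X (rational a) → Q chain₂ 3 X (rational a)
rational∈Q X a bounds Σa≡1 sat =
    (λ s i → pointwise-≤ {0ℝ} {rational a s i} (λ _ → proj₁ (bounds s i))
           , pointwise-≤ {rational a s i} {1ℝ} (λ _ → proj₂ (bounds s i)))
  , (λ i → pointwise-≡ {sum (λ s → rational a s i)} {1ℝ} λ _ → Σa≡1 i)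
  , sat

bounded? : ∀ (a : Fin 3 → Fin 2 → ℚ) → Dec (∀ s i → 0ℚ ≤ a s i × a s i ≤ 1ℚ)
bounded? a = Fin.all? λ s → Fin.all? λ i → (0ℚ ≤? a s i) ×-dec (a s i ≤? 1ℚ)

late-follower∈PA : Q chain₂ 3 PA (rational late-follower)
late-follower∈PA = rational∈Q PA late-follower (from-yes (bounded? late-follower))
  (λ { 0F → refl ; 1F → refl }) pa
  where
  mean : Fin 2 → ℝ
  mean i = sum (λ s → label s · rational late-follower s i)

  pa : Satisfies chain₂ 3 PA (rational late-follower)
  pa i j i⋖j with F⇒0⋖1 i j i⋖j
  -- Both means compute to the rational 2.
  ... | refl , refl = pointwise-≤ {mean 0F} {mean 1F} λ _ → ℚ.≤-refl

late-follower∉BW : ¬ Q chain₂ 3 BW (rational late-follower)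
-- The violation is ½ against 0; the slack ¼ is too small to cover it.
late-follower∉BW (_ , _ , bw) with bw 0F 1F 0⋖1 0F (½ * ½) (from-yes (0ℚ <? ½ * ½))
... | n , p = from-no (½ ≤? 0ℚ + ½ * ½) (p n ℕ.≤-refl)

early-follower∈BW : Q chain₂ 3 BW (rational early-follower)
early-follower∈BW = rational∈Q BW early-follower (from-yes (bounded? early-follower))
  (λ { 0F → refl ; 1F → refl }) bw
  where
  bound : Fin 3 → ℝ
  bound t = sumUpTo t (λ s → rational early-follower s 0F)

  bw : Satisfies chain₂ 3 BW (rational early-follower)
  bw i j i⋖j t with F⇒0⋖1 i j i⋖j
  ... | refl , refl = pointwise-≤ {rational early-follower t 1F} {bound t} λ n →
    -- The sequences are constant, so the decision evaluates although `n` is a variable.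
    from-yes (Fin.all? λ t → early-follower t 1F ≤? seq (bound t) n) t

early-follower∉PA : ¬ Q chain₂ 3 PA (rational early-follower)
-- The means 2 and 3/2 differ by ½, again more than the slack ¼.
early-follower∉PA (_ , _ , pa) with pa 0F 1F 0⋖1 (½ * ½) (from-yes (0ℚ <? ½ * ½))
... | n , p = from-no (1ℚ + 1ℚ ≤? (1ℚ + ½) + ½ * ½) (p n ℕ.≤-refl)

-- Comparison of the three families

PA⋢BW : ¬ Dominates PA BW
PA⋢BW PA⊑BW = late-follower∉BW (PA⊑BW chain₂ 3 {rational late-follower} late-follower∈PA)

BW⋢PA : ¬ Dominates BW PA
BW⋢PA BW⊑PA = early-follower∉PA (BW⊑PA chain₂ 3 {rational early-follower} early-follower∈BW)

proposition2 : StrictlyDominates NF PA × StrictlyDominates NF BW × Incomparable PA BW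
proposition2 =
    (NF-dominates-PA , chain₂ , 3 , _ , (λ {x} → NF-dominates-PA chain₂ 3 {x}) , λ PA⊆NF →
      -- Strictness uses the other domination: if (PA) implied (NF) here, it would also imply (BW),
      -- which this point violates. The second strictness swaps the roles.
      late-follower∉BW (NF-dominates-BW chain₂ 3 {rational late-follower}
        (PA⊆NF {rational late-follower} late-follower∈PA)))
  , (NF-dominates-BW , chain₂ , 3 , _ , (λ {x} → NF-dominates-BW chain₂ 3 {x}) , λ BW⊆NF →
      early-follower∉PA (NF-dominates-PA chain₂ 3 {rational early-follower}
        (BW⊆NF {rational early-follower} early-follower∈BW)))
  , (PA⋢BW , BW⋢PA)
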